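{- For every relation $R\subseteq\mathbb{Z}^{\mathbf{x}}\times\mathbb{Z}^{\mathbf{x}}$, $$\mathrm{wrs}(R)=\mathrm{wnt}(R)=\mathrm{gfp}(\mathrm{pre}_R).$$
   Context: $\mathbf{x}=\{x_1,\dots,x_N\}$, $N>0$, is a set of integer variables and $\mathbb{Z}^{\mathbf{x}}$ the set of valuations $\mathbf{x}\to\mathbb{Z}$. For $S\subseteq\mathbb{Z}^{\mathbf{x}}$, $\mathrm{pre}_R(S)=\{\nu\mid\exists\nu'\in S.\ (\nu,\nu')\in R\}$. $\mathrm{gfp}(F)$ is the largest set $S$ with $F(S)=S$. A set $S\subseteq\mathbb{Z}^{\mathbf{x}}$ is recurrent for $R$ if $S\subseteq\mathrm{pre}_R(S)$; $\mathrm{wrs}(R)$ (weakest recurrent set) is the union of all recurrent sets for $R$. A set $S$ is a non-termination precondition for $R$ if for each $\nu\in S$ there is an infinite sequence $\nu=\nu_0,\nu_1,\dots$ of valuations with $(\nu_i,\nu_{i+1})\in R$ for all $i\ge0$; $\mathrm{wnt}(R)$ (weakest non-termination precondition) is the union of all non-termination preconditions for $R$. -}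

module Defs where

open import Data.Integer.Base using (ℤ)
open import Data.Nat.Base using (ℕ; suc)
open import Data.Product.Base using (_×_; ∃-syntax; Σ-syntax)
open import Data.Vec.Base using (Vec)
open import Level using (Level; _⊔_) renaming (suc to lsuc)
open import Relation.Binary.Core using (Rel)
open import Relation.Binary.PropositionalEquality.Core using (_≡_)
open import Relation.Unary using (Pred; _∈_; _⊆_; _≐_)

private
  variable
    a r s ℓ : Level
    N : ℕ

-- The i-th entry is the value of the i-th variable.  Vectors rather than
-- functions Fin N → ℤ, so that pointwise equal valuations are
-- propositionally equal and every predicate is a genuine set of valuations.
Valuation : ℕ → Set
Valuation N = Vec ℤ N

pre : Rel (Valuation N) r → Pred (Valuation N) s → Pred (Valuation N) (r ⊔ s)
pre R S ν = ∃[ ν′ ] ν′ ∈ S × R ν ν′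

Recurrent : Rel (Valuation N) r → Pred (Valuation N) s → Set (r ⊔ s)
Recurrent R S = S ⊆ pre R S

InfiniteRunFrom : Rel (Valuation N) r → Pred (Valuation N) r
InfiniteRunFrom {N = N} R ν₀ =
  Σ[ ν ∈ (ℕ → Valuation N) ] ν 0 ≡ ν₀ × ((i : ℕ) → R (ν i) (ν (suc i)))

NonTerminationPrecondition : Rel (Valuation N) r → Pred (Valuation N) s → Set (r ⊔ s)
NonTerminationPrecondition R S = S ⊆ InfiniteRunFrom R

-- In wrs and wnt, the explicit level s is the universe level of the sets over
-- which the union is taken; predicativity puts the union itself at a level
-- above s.
wrs : (s : Level) → Rel (Valuation N) r → Pred (Valuation N) (r ⊔ lsuc s)
wrs {N = N} s R ν =
  Σ[ S ∈ Pred (Valuation N) s ] Recurrent R S × ν ∈ S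

wnt : (s : Level) → Rel (Valuation N) r → Pred (Valuation N) (r ⊔ lsuc s)
wnt {N = N} s R ν =
  Σ[ S ∈ Pred (Valuation N) s ] NonTerminationPrecondition R S × ν ∈ S

-- "G = gfp(F)".  A relation between F and G, since the largest fixed point
-- of an arbitrary F need not exist; it is unique up to _≐_ when it does.
record IsGfp {A : Set a} (F : Pred A ℓ → Pred A ℓ) (G : Pred A ℓ)
             : Set (a ⊔ lsuc ℓ) where
  field
    fixed    : F G ≐ G
    greatest : (T : Pred A ℓ) → F T ≐ T → T ⊆ G

{-# OPTIONS --safe #-}
-- Membership in a recurrent set carries a successor in that set, so iterating
-- it yields an infinite run; conversely, the valuations visited by an infinite
-- run form a recurrent set.  Hence both wrs and wnt consist of exactly the
-- valuations that start an infinite run, whatever the universe level of the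
-- sets in the unions, and the fixed-point property reduces to one about runs.
module Submission where

open import Level using (Level; Lift; lift)
open import Data.Nat.Base using (ℕ; zero; suc; NonZero)
open import Data.Product.Base using (Σ; _×_; _,_; proj₁; proj₂; ∃-syntax)
open import Relation.Binary.Core using (Rel)
open import Relation.Binary.PropositionalEquality.Core using (_≡_; refl)
open import Relation.Unary using (Pred; _≐_; _⊆_)
open import Defs

private
  variable
    r s : Level
    N : ℕ

module _ {R : Rel (Valuation N) r} where

  recurrent⇒nonTermination : {S : Pred (Valuation N) s} →
    Recurrent R S → NonTerminationPrecondition R S
  recurrent⇒nonTermination {S = S} rec {ν₀} ν₀∈S =
    (λ i → proj₁ (state i)) , refl , λ i → proj₂ (proj₂ (rec (proj₂ (state i))))
    where
    -- Each state keeps its membership proof, from which `rec` yields the next state.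
    state : ℕ → Σ (Valuation N) S
    state zero    = ν₀ , ν₀∈S
    state (suc i) with rec (proj₂ (state i))
    ... | ν′ , ν′∈S , _ = ν′ , ν′∈S

  run⇒wrs : InfiniteRunFrom R ⊆ wrs s R
  run⇒wrs {s = s} (ν , ν0≡ν₀ , step) =
    -- `Lift` raises the set of visited valuations from level zero to `s`.
    (λ μ → Lift s (∃[ i ] ν i ≡ μ)) ,
    (λ { (lift (i , refl)) → ν (suc i) , lift (suc i , refl) , step i }) ,
    lift (0 , ν0≡ν₀)

  run⇒wnt : InfiniteRunFrom R ⊆ wnt s R
  -- A singleton suffices: the later valuations of the run may lie outside the set.
  run⇒wnt {s = s} {ν₀} run = (λ μ → Lift s (ν₀ ≡ μ)) , (λ { (lift refl) → run }) , lift refl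

  wnt⇒run : wnt s R ⊆ InfiniteRunFrom R
  wnt⇒run (_ , nonterm , ν∈S) = nonterm ν∈S

  wrs⇒wnt : wrs s R ⊆ wnt s R
  wrs⇒wnt (S , rec , ν∈S) = S , recurrent⇒nonTermination rec , ν∈S

  run-tail : InfiniteRunFrom R ⊆ pre R (InfiniteRunFrom R)
  run-tail (ν , refl , step) = ν 1 , ((λ i → ν (suc i)) , refl , λ i → step (suc i)) , step 0

  run-cons : pre R (InfiniteRunFrom R) ⊆ InfiniteRunFrom R
  run-cons {ν₀} (_ , (ν , refl , step) , R₀) =
    (λ { zero → ν₀ ; (suc i) → ν i }) , refl , λ { zero → R₀ ; (suc i) → step i }

  wnt-isGfp : IsGfp (pre R) (wnt s R)
  wnt-isGfp = record
    { fixed    = (λ { (ν′ , ν′∈wnt , Rνν′) → run⇒wnt (run-cons (ν′ , wnt⇒run ν′∈wnt , Rνν′)) })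
               , λ ν∈wnt → let ν′ , run , Rνν′ = run-tail (wnt⇒run ν∈wnt) in ν′ , run⇒wnt run , Rνν′
    -- `T` lives at a level above `s`, so it cannot itself be a set in the union; runs bridge the
    -- levels.
    ; greatest = λ { T (_ , T⊆preT) ν∈T → run⇒wnt (recurrent⇒nonTermination T⊆preT ν∈T) }
    }

lemma3p6 : {r : Level} (s : Level) (N : ℕ) .{{_ : NonZero N}} (R : Rel (Valuation N) r) →
    (wrs s R ≐ wnt s R) × IsGfp (pre R) (wnt s R)
lemma3p6 s N R = (wrs⇒wnt , λ ν∈wnt → run⇒wrs (wnt⇒run {R = R} ν∈wnt)) , wnt-isGfp
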